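{- Let $k\ge 1$ be an integer and let $\nu\ge 2k+2$ be an even integer. Then the minimum number of edges of a $k$-extendable bipartite graph on $\nu$ vertices is exactly $\nu(k+1)/2$.
   Context: All graphs are finite, connected and simple. A connected graph $G$ on $\nu$ vertices is $k$-extendable, where $k$ is an integer with $0\le k\le (\nu-2)/2$, if $G$ contains a matching of size $k$ and every matching of size $k$ in $G$ is contained in a perfect matching of $G$. -}

module Defs where

open import Level using (0ℓ)
open import Data.Bool using (Bool)
open import Data.Fin using (Fin; _<_)
open import Data.Fin.Properties using (_<?_)
open import Data.List using (List; length; filter; allFin; cartesianProduct)
open import Data.List.Relation.Binary.Subset.Propositional using (_⊆_)
open import Data.List.Relation.Unary.AllPairs using (AllPairs)
open import Data.List.Relation.Unary.Any using (Any)
open import Data.Nat using (ℕ; _+_; _*_; _≤_)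
open import Data.Product using (_×_; _,_; ∃; ∃-syntax)
open import Data.Sum using (_⊎_)
open import Relation.Binary.Construct.Closure.ReflexiveTransitive using (Star)
open import Relation.Binary.Core using (Rel)
open import Relation.Binary.Definitions using (Symmetric; Irreflexive; Decidable)
open import Relation.Binary.PropositionalEquality using (_≡_; _≢_)
open import Relation.Nullary.Negation using (¬_)
open import Relation.Nullary.Decidable using (_×-dec_)

-- Connectedness is a separate predicate; it is required in `IsExtendable`.
record Graph (n : ℕ) : Set₁ where
  infix 4 _~_ _~?_
  field
    _~_      : Rel (Fin n) 0ℓ
    ~-sym    : Symmetric _~_
    ~-irrefl : Irreflexive _≡_ _~_
    _~?_     : Decidable _~_

module _ {n : ℕ} (G : Graph n) where
  open Graph G

  Connected : Set
  Connected = ∀ u v → Star _~_ u v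

  Bipartite : Set
  Bipartite = ∃ λ (side : Fin n → Bool) → ∀ {u v} → u ~ v → side u ≢ side v

  -- An edge {u , v} is represented by the pair (u , v) with u < v, so that
  -- every edge is listed exactly once.
  edges : List (Fin n × Fin n)
  edges = filter (λ (u , v) → (u <? v) ×-dec (u ~? v))
                 (cartesianProduct (allFin n) (allFin n))

  numEdges : ℕ
  numEdges = length edges

infix 4 _∈ᵉ_

_∈ᵉ_ : ∀ {n} → Fin n → Fin n × Fin n → Set
w ∈ᵉ (u , v) = w ≡ u ⊎ w ≡ v

Disjoint : ∀ {n} → Rel (Fin n × Fin n) 0ℓ
Disjoint e f = ∀ {w} → w ∈ᵉ e → ¬ (w ∈ᵉ f)

-- A finite set of edges is given as a list. Pairwise disjointness excludes
-- repetitions, so the length of a matching is its number of edges; the order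
-- of the list plays no role, since _⊆_ is inclusion of the sets of members.
record IsMatching {n : ℕ} (G : Graph n) (M : List (Fin n × Fin n)) : Set where
  field
    isEdges  : M ⊆ edges G
    disjoint : AllPairs Disjoint M

record IsPerfectMatching {n : ℕ} (G : Graph n) (M : List (Fin n × Fin n)) : Set where
  field
    isMatching : IsMatching G M
    covers     : ∀ w → Any (w ∈ᵉ_) M

-- The bound k ≤ (n - 2) / 2 is written without division or subtraction.
record IsExtendable {n : ℕ} (k : ℕ) (G : Graph n) : Set where
  field
    connected   : Connected G
    bound       : 2 * k + 2 ≤ n
    hasMatching : ∃[ M ] (IsMatching G M × length M ≡ k)
    extends     : ∀ M → IsMatching G M → length M ≡ k →
                  ∃[ N ] (IsPerfectMatching G N × M ⊆ N)

IsMinimum : ∀ {ℓ} → (ℕ → Set ℓ) → ℕ → Set ℓ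
IsMinimum P m = P m × (∀ {m′} → P m′ → m ≤ m′)

ExtendableBipartiteWithEdges : (k ν m : ℕ) → Set₁
ExtendableBipartiteWithEdges k ν m =
  ∃ λ (G : Graph ν) → Bipartite G × IsExtendable k G × numEdges G ≡ m

{-# OPTIONS --safe #-}
-- Lower bound: every degree is at least k + 1.  A single edge together with k - 1 edges of a
-- perfect matching is a matching, so every edge lies in a perfect matching; by connectedness
-- G - u - b then has a perfect matching for all u, b on opposite sides (grow an alternating
-- tree).  If deg u ≤ k, choose b opposite and not adjacent to u: the edges of such a matching that meet
-- the neighbours of u are at most k in number, so they extend to a perfect matching of G,
-- which leaves no partner for u.
--
-- Attained: join i to i, i + 1, …, i + k between two copies of ℤ/q.  A proper nonempty subset
-- of ℤ/q is not closed under i ↦ i + 1, hence |N(S)| ≥ min(q, |S| + k), so Hall's condition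
-- survives the removal of a matching of size k.  This graph has at most q(k + 1) edges, and
-- at least as many by the lower bound.
module Submission where

open import Defs
open import Data.Nat using (ℕ; _+_; _*_; _≤_; _/_)
open import Data.Nat.Divisibility using (_∣_)

open import Level using (0ℓ)
open import Algebra.Definitions using (Involutive)
open import Data.Bool as Bool using (Bool; true; false)
open import Data.Empty using (⊥; ⊥-elim)
open import Data.Fin as Fin using (Fin)
open import Data.Fin.Induction using (<-weakInduction; >-weakInduction)
import Data.Fin.Properties as Fin
open import Data.Fin.Properties using (_≟_; any?)
import Data.Fin.Relation.Unary.Top as Top
open import Data.List
  using (List; []; _∷_; _++_; length; map; filter; allFin; cartesianProduct; iterate; concatMap)
import Data.List.Membership.DecPropositional as DecMembership
open import Data.List.Membership.Propositional using (_∈_; _∉_; find; lose)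
open import Data.List.Membership.Propositional.Properties
  using (∈-∃++; ∈-++⁺ˡ; ∈-++⁺ʳ; ∈-++⁻; ∈-map⁺; ∈-map⁻; ∈-allFin; ∈-filter⁺; ∈-filter⁻;
         ∈-cartesianProduct⁺; ∈-concatMap⁺)
open import Data.List.Properties
  using (length-map; length-++; length-tabulate; filter-++; length-iterate)
open import Data.List.Relation.Binary.Subset.Propositional using (_⊆_)
open import Data.List.Relation.Unary.All as All using ([]; _∷_)
open import Data.List.Relation.Unary.AllPairs using (AllPairs; []; _∷_)
open import Data.List.Relation.Unary.Any as Any using (Any; here; there)
open import Data.List.Relation.Unary.Unique.Propositional using (Unique)
import Data.List.Relation.Unary.Unique.Propositional.Properties as Unique
open import Data.Nat using (zero; suc; _∸_; _<_; z≤n; s≤s)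
open import Data.Nat.Divisibility using (divides)
open import Data.Nat.DivMod using (m*n/n≡m)
import Data.Nat.Properties as ℕ
open import Data.Nat.Tactic.RingSolver using (solve-∀)
open import Data.Product as Product using (_×_; _,_; ∃; ∃-syntax; proj₁; proj₂)
open import Data.Product.Properties using (≡-dec)
open import Data.Sum as Sum using (_⊎_; inj₁; inj₂; [_,_])
open import Function using (_∘_; id)
open import Relation.Binary.Construct.Closure.ReflexiveTransitive using (Star; ε; _◅_; _◅◅_)
open import Relation.Binary.Core using (Rel)
open import Relation.Binary.Definitions using (Symmetric; Decidable; tri<; tri≈; tri>)
open import Relation.Binary.PropositionalEquality
  using (_≡_; _≢_; refl; sym; trans; cong; cong₂; subst; subst₂)
open import Relation.Nullary using (¬_; yes; no; contradiction)
open import Relation.Nullary.Decidable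
  using (Dec; does; ¬?; _×-dec_; _⊎-dec_; _→-dec_; map′; decidable-stable)

private
  variable
    A B : Set
    n : ℕ

-- Counting with duplicate-free lists

unique⇒length≤ : {xs ys : List A} → Unique xs → xs ⊆ ys → length xs ≤ length ys
unique⇒length≤ [] _ = z≤n
unique⇒length≤ {xs = x ∷ xs} (x∉xs ∷ u) x∷xs⊆ys with ∈-∃++ (x∷xs⊆ys (here refl))
... | as , bs , refl = subst (suc (length xs) ≤_) (sym lengths) (s≤s (unique⇒length≤ u xs⊆as++bs))
  where
  lengths : length (as ++ x ∷ bs) ≡ suc (length (as ++ bs))
  lengths = trans (length-++ as)
    (trans (ℕ.+-suc (length as) (length bs)) (cong suc (sym (length-++ as))))

  xs⊆as++bs : xs ⊆ as ++ bs
  xs⊆as++bs z∈xs with ∈-++⁻ as (x∷xs⊆ys (there z∈xs))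
  ... | inj₁ z∈as         = ∈-++⁺ˡ z∈as
  ... | inj₂ (here refl)  = contradiction refl (All.lookup x∉xs z∈xs)
  ... | inj₂ (there z∈bs) = ∈-++⁺ʳ as z∈bs

unique-∷ : {x : A} {xs : List A} → x ∉ xs → Unique xs → Unique (x ∷ xs)
unique-∷ x∉xs u = All.tabulate (λ { y∈xs refl → x∉xs y∈xs }) ∷ u

module _ {n : ℕ} where
  open DecMembership (_≟_ {n}) public using (_∈?_)

module _ {m n : ℕ} where
  open DecMembership (≡-dec (_≟_ {m}) (_≟_ {n})) public using () renaming (_∈?_ to _∈ₚ?_)

length-allFin : ∀ n → length (allFin n) ≡ n
length-allFin n = length-tabulate {n = n} id

uniqueFin⇒length≤ : {xs : List (Fin n)} → Unique xs → length xs ≤ n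
uniqueFin⇒length≤ {n} {xs} u = subst (length xs ≤_) (length-allFin n) (unique⇒length≤ u (λ _ → ∈-allFin _))

full⇒≤length : {xs : List (Fin n)} → (∀ w → w ∈ xs) → n ≤ length xs
full⇒≤length {n} {xs} full = subst (_≤ length xs) (length-allFin n) (unique⇒length≤ (Unique.allFin⁺ n) (λ _ → full _))

short⇒∃∉ : (xs : List (Fin n)) → length xs < n → ∃[ w ] w ∉ xs
short⇒∃∉ {n} xs short = Fin.¬∀⟶∃¬ n (_∈ xs) (_∈? xs) (λ full → ℕ.<⇒≱ short (full⇒≤length full))

-- Pigeonhole: a `y` outside the image could be prepended to `map f xs`, giving a duplicate-free
-- list inside `ys` that is longer than `xs`.
injective⇒onto : {f : A → Fin n} {xs : List A} {ys : List (Fin n)} →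
                 (∀ {x y} → f x ≡ f y → x ≡ y) → Unique xs → length ys ≤ length xs →
                 (∀ {x} → x ∈ xs → f x ∈ ys) → ∀ {y} → y ∈ ys → ∃[ x ] (x ∈ xs × y ≡ f x)
injective⇒onto {f = f} {xs} {ys} inj u ys≤xs f∈ys {y} y∈ys with y ∈? map f xs
... | yes y∈map = ∈-map⁻ f y∈map
... | no y∉map  = contradiction
  (subst (_≤ length ys) (cong suc (length-map f xs)) (unique⇒length≤ (unique-∷ y∉map (Unique.map⁺ inj u)) ⊆ys))
  (ℕ.<⇒≱ (s≤s ys≤xs))
  where
  ⊆ys : y ∷ map f xs ⊆ ys
  ⊆ys (here refl) = y∈ys
  ⊆ys (there z∈) with ∈-map⁻ f z∈
  ... | x , x∈xs , refl = f∈ys x∈xs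

-- Involutions as matchings: the fixed points are the unmatched vertices

involutive⇒injective : {g : A → A} → Involutive _≡_ g → ∀ {x y} → g x ≡ g y → x ≡ y
involutive⇒injective {g = g} inv {x} {y} eq = trans (sym (inv x)) (trans (cong g eq) (inv y))

flip : {g : A → A} → Involutive _≡_ g → ∀ {x y} → g x ≡ y → x ≡ g y
flip {g = g} inv {x} eq = trans (sym (inv x)) (cong g eq)

module _ (g : Fin n → Fin n) (x y : Fin n) where

  -- Matches x with y; their former partners become unmatched.
  switch : Fin n → Fin n
  switch w with w ≟ x
  ... | yes _ = y
  ... | no _ with w ≟ y
  ...   | yes _ = x
  ...   | no _ with w ≟ g x | w ≟ g y
  ...     | no _ | no _ = g w
  ...     | _    | _    = w

  data Switched (w : Fin n) : Fin n → Set where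
    first  : w ≡ x → Switched w y
    second : w ≡ y → Switched w x
    freed  : w ≢ x → w ≢ y → w ≡ g x ⊎ w ≡ g y → Switched w w
    kept   : w ≢ x → w ≢ y → w ≢ g x → w ≢ g y → Switched w (g w)

  switched : ∀ w → Switched w (switch w)
  switched w with w ≟ x
  ... | yes w≡x = first w≡x
  ... | no w≢x with w ≟ y
  ...   | yes w≡y = second w≡y
  ...   | no w≢y with w ≟ g x | w ≟ g y
  ...     | no w≢gx | no w≢gy = kept w≢x w≢y w≢gx w≢gy
  ...     | yes w≡gx | _ = freed w≢x w≢y (inj₁ w≡gx)
  ...     | no _ | yes w≡gy = freed w≢x w≢y (inj₂ w≡gy)

  switch-first : switch x ≡ y
  switch-first with switch x | switched x
  ... | _ | first _         = refl
  ... | _ | second x≡y      = x≡y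
  ... | _ | freed x≢x _ _   = contradiction refl x≢x
  ... | _ | kept x≢x _ _ _  = contradiction refl x≢x

  switch-second : switch y ≡ x
  switch-second with switch y | switched y
  ... | _ | first y≡x       = y≡x
  ... | _ | second _        = refl
  ... | _ | freed _ y≢y _   = contradiction refl y≢y
  ... | _ | kept _ y≢y _ _  = contradiction refl y≢y

  switch-freed : ∀ {w} → w ≢ x → w ≢ y → w ≡ g x ⊎ w ≡ g y → switch w ≡ w
  switch-freed {w} w≢x w≢y w≡ with switch w | switched w
  ... | _ | first w≡x          = contradiction w≡x w≢x
  ... | _ | second w≡y         = contradiction w≡y w≢y
  ... | _ | freed _ _ _        = refl
  ... | _ | kept _ _ w≢gx w≢gy = ⊥-elim ([ w≢gx , w≢gy ] w≡)

  switch-kept : ∀ {w} → w ≢ x → w ≢ y → w ≢ g x → w ≢ g y → switch w ≡ g w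
  switch-kept {w} w≢x w≢y w≢gx w≢gy with switch w | switched w
  ... | _ | first w≡x    = contradiction w≡x w≢x
  ... | _ | second w≡y   = contradiction w≡y w≢y
  ... | _ | freed _ _ w≡ = ⊥-elim ([ w≢gx , w≢gy ] w≡)
  ... | _ | kept _ _ _ _ = refl

  module _ (inv : Involutive _≡_ g) where

    switch-involutive : Involutive _≡_ switch
    switch-involutive w with switch w | switched w
    ... | _ | first refl  = switch-second
    ... | _ | second refl = switch-first
    ... | _ | freed w≢x w≢y w≡ = switch-freed w≢x w≢y w≡
    ... | _ | kept w≢x w≢y w≢gx w≢gy = trans
      (switch-kept (w≢gx ∘ flip inv) (w≢gy ∘ flip inv)
        (w≢x ∘ involutive⇒injective inv) (w≢y ∘ involutive⇒injective inv))
      (inv w)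

Valid : Rel (Fin n) 0ℓ → (Fin n → Fin n) → Set
Valid _R_ g = ∀ w → g w ≡ w ⊎ w R g w

switch-valid : {_R_ : Rel (Fin n) 0ℓ} → Symmetric _R_ → ∀ {g x y} → Valid _R_ g → x R y →
               Valid _R_ (switch g x y)
switch-valid R-sym {g} {x} {y} valid xRy w with switch g x y w | switched g x y w
... | _ | first refl   = inj₂ xRy
... | _ | second refl  = inj₂ (R-sym xRy)
... | _ | freed _ _ _  = inj₁ refl
... | _ | kept _ _ _ _ = valid w

-- Alternating trees

module AlternatingTree
  {_R_ : Rel (Fin n) 0ℓ} (R-sym : Symmetric _R_) (_R?_ : Decidable _R_)
  -- `C` and `D` are the two classes between which trees alternate. They need not exhaust the
  -- vertices, so the vertices covered by a prescribed matching can be kept out of them.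
  (C D : Fin n → Set) (C⇒D : ∀ {x y} → x R y → C x → D y) (D⇒C : ∀ {x y} → x R y → D x → C y)
  (disjoint : ∀ {x} → C x → ¬ D x)
  {g : Fin n → Fin n} (inv : Involutive _≡_ g) (valid : Valid _R_ g)
  {r : Fin n} (r∈C : C r) (r-unmatched : g r ≡ r)
  where

  -- A matching that leaves s unmatched in place of the root r, obtained from g by
  -- changes at vertices of S and their partners only.
  record Exposing (S : List (Fin n)) (s : Fin n) : Set where
    field
      h          : Fin n → Fin n
      h-inv      : Involutive _≡_ h
      h-valid    : Valid _R_ h
      exposed    : h s ≡ s
      unmatched  : ∀ {w} → h w ≡ w → w ≡ s ⊎ (g w ≡ w × w ≢ r)
      -- `S` lists only the tree vertices in `C`; those in `D` are partners of entries of `S`. So a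
      -- vertex is off the tree when neither it nor its partner is in `S`.
      agree      : ∀ {w} → w ∉ S → g w ∉ S → h w ≡ g w

  record Tree (S : List (Fin n)) : Set where
    field
      unique   : Unique S
      root     : r ∈ S
      inC      : ∀ {s} → s ∈ S → C s
      exposing : ∀ {s} → s ∈ S → Exposing S s

  -- The two ways in which the growth of a tree ends. If `closed`, every neighbour `y` of `S` is
  -- matched into `S`, as an unmatched `y` would be in `D` while `S` lies in `C`: this is a Hall
  -- obstruction. If `stuck`, `y` is the end of an augmenting path.
  data Final (S : List (Fin n)) : Set where
    closed : (∀ {s y} → s ∈ S → s R y → g y ∈ S) → Final S
    stuck  : ∀ {s y} → s ∈ S → s R y → g y ≡ y → Final S

  singleton : Tree (r ∷ [])
  singleton = record
    { unique = [] ∷ []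
    ; root = here refl
    ; inC = λ { (here refl) → r∈C }
    ; exposing = λ { (here refl) → record
        { h = g ; h-inv = inv ; h-valid = valid ; exposed = r-unmatched
        ; unmatched = unmatched ; agree = λ _ _ → refl } }
    }
    where
    unmatched : ∀ {w} → g w ≡ w → w ≡ r ⊎ (g w ≡ w × w ≢ r)
    unmatched {w} gw≡w with w ≟ r
    ... | yes w≡r = inj₁ w≡r
    ... | no w≢r  = inj₂ (gw≡w , w≢r)

  module Step {S : List (Fin n)} (T : Tree S) {s y : Fin n} (s∈S : s ∈ S) (sRy : s R y)
              (gy∉S : g y ∉ S) where
    open Tree T

    y∈D : D y
    y∈D = C⇒D sRy (inC s∈S)

    ∈S⇒≢y : ∀ {w} → w ∈ S → w ≢ y
    ∈S⇒≢y w∈S refl = disjoint (inC w∈S) y∈D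

    module _ (gy≢y : g y ≢ y) where

      gy∈C : C (g y)
      gy∈C with valid y
      ... | inj₁ gy≡y = contradiction gy≡y gy≢y
      ... | inj₂ yRgy = D⇒C yRgy y∈D

      -- In the matching `h` that exposes `s`, matching `s` with `y` frees the partner of `y`. That
      -- partner is still `g y`, because neither `y` nor `g y` is in `S`.
      new : Exposing (g y ∷ S) (g y)
      new = record
        { h = switch h y s
        ; h-inv = switch-involutive h y s h-inv
        ; h-valid = switch-valid R-sym h-valid (R-sym sRy)
        ; exposed = switch-freed h y s gy≢y (λ { refl → gy∉S s∈S }) (inj₁ (sym hy≡gy))
        ; unmatched = unmatched′
        ; agree = agree′
        }
        where
        open Exposing (exposing s∈S)
        hy≡gy : h y ≡ g y
        hy≡gy = agree (λ y∈S → ∈S⇒≢y y∈S refl) gy∉S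

        unmatched′ : ∀ {w} → switch h y s w ≡ w → w ≡ g y ⊎ (g w ≡ w × w ≢ r)
        unmatched′ {w} eq with switch h y s w | switched h y s w
        ... | _ | first refl  = contradiction eq (∈S⇒≢y s∈S)
        ... | _ | second refl = contradiction (sym eq) (∈S⇒≢y s∈S)
        ... | _ | freed _ _ (inj₁ w≡hy) = inj₁ (trans w≡hy hy≡gy)
        ... | _ | freed _ w≢s (inj₂ w≡hs) = contradiction (trans w≡hs exposed) w≢s
        ... | _ | kept _ w≢s _ _ with unmatched eq
        ...   | inj₁ w≡s = contradiction w≡s w≢s
        ...   | inj₂ old = inj₂ old

        agree′ : ∀ {w} → w ∉ g y ∷ S → g w ∉ g y ∷ S → switch h y s w ≡ g w
        agree′ {w} w∉ gw∉ = trans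
          (switch-kept h y s
            (λ { refl → gw∉ (here refl) }) (λ { refl → w∉ (there s∈S) })
            (λ w≡hy → w∉ (here (trans w≡hy hy≡gy)))
            (λ w≡hs → w∉ (there (subst (_∈ S) (sym (trans w≡hs exposed)) s∈S))))
          (agree (w∉ ∘ there) (gw∉ ∘ there))

      extend : Tree (g y ∷ S)
      extend = record
        { unique = unique-∷ gy∉S unique
        ; root = there root
        ; inC = λ { (here refl) → gy∈C ; (there s∈) → inC s∈ }
        ; exposing = λ
          { (here refl) → new
          ; (there s∈) → let open Exposing (exposing s∈) in record
            { h = h ; h-inv = h-inv ; h-valid = h-valid ; exposed = exposed
            ; unmatched = unmatched ; agree = λ w∉ gw∉ → agree (w∉ ∘ there) (gw∉ ∘ there) } }
        }

  -- Every step lengthens the duplicate-free list `S`, which has at most `n` entries, so the fuel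
  -- cannot run out.
  grow : ∀ fuel {S} → Tree S → n < fuel + length S → ∃[ S′ ] (Tree S′ × Final S′)
  grow zero T n<S = contradiction (uniqueFin⇒length≤ (Tree.unique T)) (ℕ.<⇒≱ n<S)
  grow (suc fuel) {S} T n<S with any? (λ y → Any.any? (_R? y) S ×-dec ¬? (g y ∈? S))
  ... | no none = S , T , closed λ {s} {y} s∈S sRy →
    decidable-stable (g y ∈? S) (λ gy∉S → none (y , lose s∈S sRy , gy∉S))
  ... | yes (y , SRy , gy∉S) with find SRy
  ...   | s , s∈S , sRy with g y ≟ y
  ...     | yes gy≡y = S , T , stuck s∈S sRy gy≡y
  ...     | no gy≢y = grow fuel (Step.extend T s∈S sRy gy∉S gy≢y)
                        (subst (n <_) (sym (ℕ.+-suc fuel (length S))) n<S)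

  tree : ∃[ S ] (Tree S × Final S)
  tree = grow (suc n) singleton (s≤s (ℕ.m≤m+n n 1))

  -- In the matching `h` that exposes `s`, both `s` and `y` are unmatched, so matching them with
  -- each other frees no vertex.
  augment : ∀ {S s y} → Tree S → s ∈ S → s R y → g y ≡ y →
            ∃[ g′ ] (Involutive _≡_ g′ × Valid _R_ g′ × (∀ {w} → g′ w ≡ w → g w ≡ w × w ≢ r))
  augment {S} {s} {y} T s∈S sRy gy≡y =
    switch h y s , switch-involutive h y s h-inv , switch-valid R-sym h-valid (R-sym sRy) , unmatched′
    where
    open Tree T
    open Exposing (exposing s∈S)
    y∉S : y ∉ S
    y∉S y∈S = disjoint (inC y∈S) (C⇒D sRy (inC s∈S))

    hy≡y : h y ≡ y
    hy≡y = trans (agree y∉S (y∉S ∘ subst (_∈ S) gy≡y)) gy≡y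

    unmatched′ : ∀ {w} → switch h y s w ≡ w → g w ≡ w × w ≢ r
    unmatched′ {w} eq with switch h y s w | switched h y s w
    ... | _ | first refl  = contradiction (subst (_∈ S) eq s∈S) y∉S
    ... | _ | second refl = contradiction (subst (_∈ S) (sym eq) s∈S) y∉S
    ... | _ | freed w≢y _ (inj₁ w≡hy) = contradiction (trans w≡hy hy≡y) w≢y
    ... | _ | freed _ w≢s (inj₂ w≡hs) = contradiction (trans w≡hs exposed) w≢s
    ... | _ | kept _ w≢s _ _ with unmatched eq
    ...   | inj₁ w≡s = contradiction w≡s w≢s
    ...   | inj₂ old = old

-- Matchings given by lists of edges

Joined : List (Fin n × Fin n) → Rel (Fin n) 0ℓ
Joined M x y = (x , y) ∈ M ⊎ (y , x) ∈ M

joined? : (M : List (Fin n × Fin n)) → Decidable (Joined M)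
joined? M x y = ((x , y) ∈ₚ? M) ⊎-dec ((y , x) ∈ₚ? M)

joined-sym : {M : List (Fin n × Fin n)} → Symmetric (Joined M)
joined-sym (inj₁ xy∈M) = inj₂ xy∈M
joined-sym (inj₂ yx∈M) = inj₁ yx∈M

joined-mono : {M N : List (Fin n × Fin n)} → M ⊆ N → ∀ {x y} → Joined M x y → Joined N x y
joined-mono M⊆N (inj₁ xy∈M) = inj₁ (M⊆N xy∈M)
joined-mono M⊆N (inj₂ yx∈M) = inj₂ (M⊆N yx∈M)

Covered : List (Fin n × Fin n) → Fin n → Set
Covered M x = ∃ (Joined M x)

covered? : (M : List (Fin n × Fin n)) → ∀ x → Dec (Covered M x)
covered? M x = any? (joined? M x)

any⇒covered : {M : List (Fin n × Fin n)} {w : Fin n} → Any (w ∈ᵉ_) M → Covered M w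
any⇒covered w∈ with find w∈
... | (u , v) , uv∈M , inj₁ refl = v , inj₁ uv∈M
... | (u , v) , uv∈M , inj₂ refl = u , inj₂ uv∈M

covered⇒any : {M : List (Fin n × Fin n)} {w : Fin n} → Covered M w → Any (w ∈ᵉ_) M
covered⇒any (_ , inj₁ wy∈M) = lose wy∈M (inj₁ refl)
covered⇒any (_ , inj₂ yw∈M) = lose yw∈M (inj₂ refl)

disjoint⇒≡ : {M : List (Fin n × Fin n)} → AllPairs Disjoint M → ∀ {e f w} →
             e ∈ M → f ∈ M → w ∈ᵉ e → w ∈ᵉ f → e ≡ f
disjoint⇒≡ _ (here refl) (here refl) _ _ = refl
disjoint⇒≡ (d ∷ _) (here refl) (there f∈) w∈e w∈f = contradiction w∈f (All.lookup d f∈ w∈e)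
disjoint⇒≡ (d ∷ _) (there e∈) (here refl) w∈e w∈f = contradiction w∈e (All.lookup d e∈ w∈f)
disjoint⇒≡ (_ ∷ ds) (there e∈) (there f∈) w∈e w∈f = disjoint⇒≡ ds e∈ f∈ w∈e w∈f

joined-functional : {M : List (Fin n × Fin n)} → AllPairs Disjoint M → ∀ {x y z} →
                    Joined M x y → Joined M x z → y ≡ z
joined-functional d (inj₁ p) (inj₁ q) with disjoint⇒≡ d p q (inj₁ refl) (inj₁ refl)
... | refl = refl
joined-functional d (inj₁ p) (inj₂ q) with disjoint⇒≡ d p q (inj₁ refl) (inj₂ refl)
... | refl = refl
joined-functional d (inj₂ p) (inj₁ q) with disjoint⇒≡ d p q (inj₂ refl) (inj₁ refl)
... | refl = refl
joined-functional d (inj₂ p) (inj₂ q) with disjoint⇒≡ d p q (inj₂ refl) (inj₂ refl)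
... | refl = refl

opaque
  disjoint⇒involution : {M : List (Fin n × Fin n)} → AllPairs Disjoint M →
    ∃[ g ] (Involutive _≡_ g × (∀ {x y} → Joined M x y → g x ≡ y) × Valid (Joined M) g)
  disjoint⇒involution {n} {M} d = g , inv , joined , valid
    where
    g : Fin n → Fin n
    g x with covered? M x
    ... | yes (y , _) = y
    ... | no _        = x

    joined : ∀ {x y} → Joined M x y → g x ≡ y
    joined {x} xy with covered? M x
    ... | yes (_ , xz) = joined-functional d xz xy
    ... | no uncovered = contradiction (_ , xy) uncovered

    valid : Valid (Joined M) g
    valid x with covered? M x
    ... | yes (_ , xy) = inj₂ xy
    ... | no _         = inj₁ refl

    inv : Involutive _≡_ g
    inv x with valid x
    ... | inj₁ gx≡x = trans (cong g gx≡x) gx≡x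
    ... | inj₂ xgx  = joined (joined-sym xgx)

-- Translation between edge lists and involutions in a graph

module Matchings {n : ℕ} (G : Graph n) where
  open Graph G

  ∈edges⁺ : ∀ {u v} → u Fin.< v → u ~ v → (u , v) ∈ edges G
  ∈edges⁺ u<v u~v = ∈-filter⁺ (λ (u , v) → (u Fin.<? v) ×-dec (u ~? v))
    (∈-cartesianProduct⁺ (∈-allFin _) (∈-allFin _)) (u<v , u~v)

  ∈edges⁻ : ∀ {u v} → (u , v) ∈ edges G → u Fin.< v × u ~ v
  ∈edges⁻ uv∈ = proj₂ (∈-filter⁻ (λ (u , v) → (u Fin.<? v) ×-dec (u ~? v))
    {xs = cartesianProduct (allFin n) (allFin n)} uv∈)

  edges-unique : Unique (edges G)
  edges-unique = Unique.filter⁺ (λ (u , v) → (u Fin.<? v) ×-dec (u ~? v))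
    (Unique.cartesianProduct⁺ (Unique.allFin⁺ n) (Unique.allFin⁺ n))

  orient : ∀ {u v} → u ~ v → ∃[ e ] (e ∈ edges G × (e ≡ (u , v) ⊎ e ≡ (v , u)))
  orient {u} {v} u~v with Fin.<-cmp u v
  ... | tri< u<v _ _ = (u , v) , ∈edges⁺ u<v u~v , inj₁ refl
  ... | tri≈ _ u≡v _ = contradiction u~v (~-irrefl u≡v)
  ... | tri> _ _ v<u = (v , u) , ∈edges⁺ v<u (~-sym u~v) , inj₂ refl

  joined⇒~ : ∀ {M} → IsMatching G M → ∀ {x y} → Joined M x y → x ~ y
  joined⇒~ matching (inj₁ xy∈M) = proj₂ (∈edges⁻ (IsMatching.isEdges matching xy∈M))
  joined⇒~ matching (inj₂ yx∈M) = ~-sym (proj₂ (∈edges⁻ (IsMatching.isEdges matching yx∈M)))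

  perfect⇒involution : ∀ {N} → IsPerfectMatching G N →
    ∃[ P ] (Involutive _≡_ P × (∀ w → w ~ P w) × (∀ {x y} → Joined N x y → P x ≡ y))
  perfect⇒involution perfect with disjoint⇒involution (IsMatching.disjoint (IsPerfectMatching.isMatching perfect))
  ... | P , inv , joined , _ = P , inv , adj , joined
    where
    open IsPerfectMatching perfect
    adj : ∀ w → w ~ P w
    adj w with any⇒covered (covers w)
    ... | y , wy = subst (w ~_) (sym (joined wy)) (joined⇒~ isMatching wy)

  module Greedy {g : Fin n → Fin n} (inv : Involutive _≡_ g) where

    record Along (M : List (Fin n × Fin n)) : Set where
      field
        isMatching : IsMatching G M
        along      : ∀ {x y} → (x , y) ∈ M → g x ≡ y

      joinedAlong : ∀ {x y} → Joined M x y → g x ≡ y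
      joinedAlong (inj₁ xy∈M) = along xy∈M
      joinedAlong (inj₂ yx∈M) = sym (flip inv (along yx∈M))

    empty : Along []
    empty = record { isMatching = record { isEdges = λ () ; disjoint = [] } ; along = λ () }

    -- Two pairs of the form `w`, `g w` are equal or disjoint. Hence if `w` is uncovered then so is
    -- `g w`, and the new edge meets no old one.
    add : ∀ {M w} → Along M → w ~ g w → ¬ Covered M w → ∃[ e ] (Along (e ∷ M) × Covered (e ∷ M) w)
    add {M} {w} A w~gw uncovered with orient w~gw
    ... | e , e∈ , e≡ = e , record
        { isMatching = record
          { isEdges = λ { (here refl) → e∈ ; (there f∈) → isEdges f∈ }
          ; disjoint = All.tabulate (λ f∈ v∈e v∈f → uncovered (meets e≡ f∈ v∈e v∈f)) ∷ disjoint
          }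
        ; along = λ { (here refl) → alongNew e≡ ; (there f∈) → along f∈ }
        } , covers e≡
      where
      open Along A
      open IsMatching isMatching
      alongNew : ∀ {x y} → (x , y) ≡ (w , g w) ⊎ (x , y) ≡ (g w , w) → g x ≡ y
      alongNew (inj₁ refl) = refl
      alongNew (inj₂ refl) = inv w

      covers : ∀ {e} → e ≡ (w , g w) ⊎ e ≡ (g w , w) → Covered (e ∷ M) w
      covers (inj₁ refl) = g w , inj₁ (here refl)
      covers (inj₂ refl) = g w , inj₂ (here refl)

      either : ∀ {v} → Covered M v → v ≡ w ⊎ v ≡ g w → Covered M w
      either c (inj₁ refl) = c
      either (y , vy) (inj₂ refl) with trans (sym (joinedAlong vy)) (inv w)
      ... | refl = g w , joined-sym vy

      meets : ∀ {e f v} → e ≡ (w , g w) ⊎ e ≡ (g w , w) → f ∈ M → v ∈ᵉ e → v ∈ᵉ f → Covered M w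
      meets (inj₁ refl) f∈ v∈e v∈f = either (any⇒covered (lose f∈ v∈f)) v∈e
      meets (inj₂ refl) f∈ v∈e v∈f = either (any⇒covered (lose f∈ v∈f)) (Sum.swap v∈e)

    cover : ∀ {M} → Along M → ∀ ws → (∀ {w} → w ∈ ws → w ~ g w) →
            ∃[ M′ ] (Along M′ × M ⊆ M′ × (∀ {w} → w ∈ ws → Covered M′ w) ×
                     length M′ ≤ length ws + length M)
    cover {M} A [] _ = M , A , id , (λ ()) , ℕ.≤-refl
    cover A (w ∷ ws) adj with cover A ws (adj ∘ there)
    ... | M′ , A′ , M⊆M′ , covers , len with covered? M′ w
    ...   | yes c = M′ , A′ , M⊆M′ , (λ { (here refl) → c ; (there v∈) → covers v∈ }) , ℕ.m≤n⇒m≤1+n len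
    ...   | no ¬c with add A′ (adj (here refl)) ¬c
    ...     | e , A″ , c = e ∷ M′ , A″ , there ∘ M⊆M′
              , (λ { (here refl) → c ; (there v∈) → let y , vy = covers v∈ in y , joined-mono there vy })
              , s≤s len

    -- The vertices `p` and `q` are those at which `g` may fail to give an edge. While edges are
    -- still missing, `p`, `q` and the endpoints of `M` do not exhaust the vertices; the summand 2
    -- in the bound makes room for `p` and `q`.
    pad : ∀ {p q} → (∀ {w} → w ≢ p → w ≢ q → w ~ g w) → ∀ d {M} → Along M → 2 * (d + length M) + 2 ≤ n →
          ∃[ M′ ] (Along M′ × M ⊆ M′ × length M′ ≡ d + length M)
    pad _ zero {M} A _ = M , A , id , refl
    pad {p} {q} adj (suc d) {M} A bound with short⇒∃∉ (p ∷ q ∷ map proj₁ M ++ map proj₂ M) short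
      where
      short : length (p ∷ q ∷ map proj₁ M ++ map proj₂ M) < n
      short = ℕ.≤-trans (subst (λ ℓ → 3 + ℓ ≤ 2 * (suc d + length M) + 2) (sym lengths) arith) bound
        where
        lengths : length (map proj₁ M ++ map proj₂ M) ≡ length M + length M
        lengths = trans (length-++ (map proj₁ M))
          (cong₂ _+_ (length-map proj₁ M) (length-map proj₂ M))
        rearrange : ∀ d m → 2 * (suc d + m) + 2 ≡ 3 + (m + m) + (1 + d + d)
        rearrange = solve-∀
        arith : 3 + (length M + length M) ≤ 2 * (suc d + length M) + 2
        arith = subst (3 + (length M + length M) ≤_) (sym (rearrange d (length M))) (ℕ.m≤m+n _ _)
    ... | w , w∉ with add A (adj (λ { refl → w∉ (here refl) }) (λ { refl → w∉ (there (here refl)) })) uncovered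
      where
      uncovered : ¬ Covered M w
      uncovered (y , inj₁ wy∈M) = w∉ (there (there (∈-++⁺ˡ (∈-map⁺ proj₁ wy∈M))))
      uncovered (y , inj₂ yw∈M) = w∉ (there (there (∈-++⁺ʳ (map proj₁ M) (∈-map⁺ proj₂ yw∈M))))
    ... | e , A′ , _ with pad adj d A′ (subst (λ m → 2 * m + 2 ≤ n) (sym (ℕ.+-suc d (length M))) bound)
    ...   | M′ , A″ , eM⊆M′ , len = M′ , A″ , eM⊆M′ ∘ there , trans len (ℕ.+-suc d (length M))

  -- Perfect matchings obtained from extendability

  module Extendable {k : ℕ} (ext : IsExtendable k G) where
    open IsExtendable ext

    opaque
      perfectInvolution : ∃[ P ] (Involutive _≡_ P × (∀ w → w ~ P w))
      perfectInvolution with hasMatching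
      ... | M , matching , size with extends M matching size
      ...   | N , perfect , _ with perfect⇒involution perfect
      ...     | P , inv , adj , _ = P , inv , adj

      -- The pairs of `g` at the vertices of `ws` are at most `k` edges. Extendability concerns
      -- matchings of size exactly `k`, so further pairs of `g` away from `p` and `q` are added
      -- before extending.
      extendInvolution : ∀ {g} → Involutive _≡_ g → ∀ {p q} → (∀ {w} → w ≢ p → w ≢ q → w ~ g w) →
        ∀ ws → length ws ≤ k → (∀ {w} → w ∈ ws → w ~ g w) →
        ∃[ P ] (Involutive _≡_ P × (∀ w → w ~ P w) × (∀ {w} → w ∈ ws → P w ≡ g w))
      extendInvolution {g} inv adj ws ws≤k ws-adj with Greedy.cover inv (Greedy.empty inv) ws ws-adj
      ... | M , A , _ , covers , len
        with Greedy.pad inv adj (k ∸ length M) A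
               (subst (λ m → 2 * m + 2 ≤ n) (sym (ℕ.m∸n+n≡m M≤k)) bound)
        where
        M≤k : length M ≤ k
        M≤k = ℕ.≤-trans len (subst (_≤ k) (sym (ℕ.+-identityʳ (length ws))) ws≤k)
      ... | M′ , A′ , M⊆M′ , len′
        with extends M′ (Greedy.Along.isMatching A′)
               (trans len′ (ℕ.m∸n+n≡m (ℕ.≤-trans len (subst (_≤ k) (sym (ℕ.+-identityʳ (length ws))) ws≤k))))
      ... | N , perfect , M′⊆N with perfect⇒involution perfect
      ... | P , P-inv , P-adj , joined = P , P-inv , P-adj , λ w∈ →
        let y , wy = covers w∈ in
        trans (joined (joined-mono (M′⊆N ∘ M⊆M′) wy)) (sym (Greedy.Along.joinedAlong A wy))

      switch-adj : ∀ {P} → (∀ w → w ~ P w) → ∀ {x y} → x ~ y →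
                   ∀ {w} → w ≢ P x → w ≢ P y → w ~ switch P x y w
      switch-adj {P} adj {x} {y} x~y {w} w≢Px w≢Py with switch P x y w | switched P x y w
      ... | _ | first refl   = x~y
      ... | _ | second refl  = ~-sym x~y
      ... | _ | freed _ _ w≡ = ⊥-elim ([ w≢Px , w≢Py ] w≡)
      ... | _ | kept _ _ _ _ = adj w

      -- Switching a perfect matching so that it uses the edge from `x` to `y` frees at most `P x`
      -- and `P y`, which are the two exceptions that `extendInvolution` allows. Only the partner of
      -- `x` is prescribed, whence `1 ≤ k`.
      throughEdge : 1 ≤ k → ∀ {x y} → x ~ y → ∃[ Q ] (Involutive _≡_ Q × (∀ w → w ~ Q w) × Q x ≡ y)
      throughEdge 1≤k {x} {y} x~y = let P , inv , adj = perfectInvolution in modify P inv adj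
        where
        modify : ∀ P → Involutive _≡_ P → (∀ w → w ~ P w) →
                 ∃[ Q ] (Involutive _≡_ Q × (∀ w → w ~ Q w) × Q x ≡ y)
        modify P inv adj =
          let Q , Q-inv , Q-adj , Q≡ = extendInvolution (switch-involutive P x y inv) {P x} {P y} (switch-adj adj x~y)
                (x ∷ []) 1≤k (λ { (here refl) → subst (x ~_) (sym (switch-first P x y)) x~y })
          in Q , Q-inv , Q-adj , trans (Q≡ (here refl)) (switch-first P x y)

-- Lower bound: every degree exceeds k

≢-≢⇒≡ : {a b c : Bool} → a ≢ b → b ≢ c → a ≡ c
≢-≢⇒≡ {false} {false}         a≢b _   = contradiction refl a≢b
≢-≢⇒≡ {false} {true}  {false} _   _   = refl
≢-≢⇒≡ {false} {true}  {true}  _   b≢c = contradiction refl b≢c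
≢-≢⇒≡ {true}  {false} {false} _   b≢c = contradiction refl b≢c
≢-≢⇒≡ {true}  {false} {true}  _   _   = refl
≢-≢⇒≡ {true}  {true}          a≢b _   = contradiction refl a≢b

module MinimumDegree {n : ℕ} {G : Graph n} (bipartite : Bipartite G) {k : ℕ} (1≤k : 1 ≤ k)
                     (ext : IsExtendable k G) where
  open Graph G
  open IsExtendable ext
  open Matchings.Extendable G ext

  side : Fin n → Bool
  side = proj₁ bipartite

  ~⇒side≢ : ∀ {x y} → x ~ y → side x ≢ side y
  ~⇒side≢ = proj₂ bipartite

  ~⇒≢ : ∀ {x y} → x ~ y → x ≢ y
  ~⇒≢ x~y x≡y = ~-irrefl x≡y x~y

  neighbours : Fin n → List (Fin n)
  neighbours u = filter (u ~?_) (allFin n)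

  ∈neighbours⁺ : ∀ {u v} → u ~ v → v ∈ neighbours u
  ∈neighbours⁺ {u} u~v = ∈-filter⁺ (u ~?_) (∈-allFin _) u~v

  ∈neighbours⁻ : ∀ {u v} → v ∈ neighbours u → u ~ v
  ∈neighbours⁻ {u} v∈ = proj₂ (∈-filter⁻ (u ~?_) {xs = allFin n} v∈)

  module SmallDegree (u : Fin n) (degree≤k : length (neighbours u) ≤ k)
                     {P : Fin n → Fin n} (P-inv : Involutive _≡_ P) (P-adj : ∀ w → w ~ P w) where

    -- The edges of the graph with `u` deleted. The tree is rooted at `P u`, the vertex that loses
    -- its partner by the deletion.
    _R_ : Rel (Fin n) 0ℓ
    x R y = x ~ y × x ≢ u × y ≢ u

    Far Near : Fin n → Set
    Far w = side w ≢ side u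
    Near w = side w ≡ side u

    far⇒near : ∀ {x y} → x ~ y → Far x → Near y
    far⇒near x~y far = ≢-≢⇒≡ (~⇒side≢ (~-sym x~y)) far

    near⇒far : ∀ {x y} → x ~ y → Near x → Far y
    near⇒far x~y near y≡u = ~⇒side≢ x~y (trans near (sym y≡u))

    -- With both arguments equal, `switch` removes the edge at `u`: the fixed points become `u` and
    -- `P u`, and all other pairs of `P` stay.
    g : Fin n → Fin n
    g = switch P u u

    g-valid : Valid _R_ g
    g-valid w with switch P u u w | switched P u u w
    ... | _ | first w≡u  = inj₁ (sym w≡u)
    ... | _ | second w≡u = inj₁ (sym w≡u)
    ... | _ | freed _ _ _ = inj₁ refl
    ... | _ | kept w≢u _ w≢Pu _ = inj₂ (P-adj w , w≢u , w≢Pu ∘ flip P-inv)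

    Pu-far : Far (P u)
    Pu-far = near⇒far (P-adj u) refl

    open AlternatingTree
      {_R_ = _R_} (λ (x~y , x≢u , y≢u) → ~-sym x~y , y≢u , x≢u)
      (λ x y → (x ~? y) ×-dec (¬? (x ≟ u) ×-dec ¬? (y ≟ u)))
      Far Near (far⇒near ∘ proj₁) (near⇒far ∘ proj₁) id
      (switch-involutive P u u P-inv) g-valid Pu-far
      (switch-freed P u u (~⇒≢ (~-sym (P-adj u))) (~⇒≢ (~-sym (P-adj u))) (inj₁ refl))

    g-kept : ∀ {w} → w ≢ u → w ≢ P u → g w ≡ P w
    g-kept w≢u w≢Pu = switch-kept P u u w≢u w≢u w≢Pu w≢Pu

    fixed⇒ : ∀ {w} → g w ≡ w → w ≢ P u → w ≡ u
    fixed⇒ {w} gw≡w w≢Pu = decidable-stable (w ≟ u) λ w≢u →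
      ~⇒≢ (P-adj w) (trans (sym gw≡w) (g-kept w≢u w≢Pu))

    near⇒≢Pu : ∀ {w} → Near w → w ≢ P u
    near⇒≢Pu near refl = Pu-far near

    module _ {S : List (Fin n)} (T : Tree S) where
      open Tree T

      module _ (P-closed : ∀ {s y} → s ∈ S → s ~ y → P y ∈ S) where

        Reached : Fin n → Set
        Reached w = w ∈ S ⊎ P w ∈ S

        -- If an edge left S ∪ P(S) at x ∈ P(S), a perfect matching Q through it would map
        -- S injectively into P(S) while missing x.
        reached-step : ∀ {x y} → x ~ y → Reached x → Reached y
        reached-step x~y (inj₁ x∈S) = inj₂ (P-closed x∈S x~y)
        reached-step {x} {y} x~y (inj₂ Px∈S) =
          let Q , Q-inv , Q-adj , Qx≡y = throughEdge 1≤k x~y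
              s , s∈S , Px≡PQs = injective⇒onto {f = P ∘ Q}
                (involutive⇒injective {g = Q} Q-inv ∘ involutive⇒injective {g = P} P-inv) unique ℕ.≤-refl
                (λ {s} s∈S → P-closed s∈S (Q-adj s)) Px∈S
              s≡Qx = flip {g = Q} Q-inv (sym (involutive⇒injective {g = P} P-inv Px≡PQs))
          in inj₁ (subst (_∈ S) (trans s≡Qx Qx≡y) s∈S)

        reached : ∀ w → Reached w
        reached w = walk (connected u w) (inj₂ root)
          where
          walk : ∀ {x y} → Star _~_ x y → Reached x → Reached y
          walk ε reached = reached
          walk (x~y ◅ y~*z) reached = walk y~*z (reached-step x~y reached)

        -- So the tree contains the whole side opposite to `u` and can expose any `b` there, which
        -- is a perfect matching of the graph without `u` and `b`.
        far⇒∈S : ∀ {w} → Far w → w ∈ S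
        far⇒∈S {w} far with reached w
        ... | inj₁ w∈S  = w∈S
        ... | inj₂ Pw∈S = contradiction (far⇒near (P-adj w) far) (inC Pw∈S)

        -- Otherwise the neighbours of `u` and their partners under `P` would be all the vertices,
        -- so that `n` would be at most `2 * k`.
        farNonNeighbour : ∃[ b ] (Far b × ¬ (u ~ b))
        farNonNeighbour with any? (λ b → ¬? (side b Bool.≟ side u) ×-dec ¬? (u ~? b))
        ... | yes found = found
        ... | no none = contradiction (ℕ.≤-trans bound (full⇒≤length full)) (ℕ.<⇒≱ few)
          where
          L = neighbours u

          far⇒∈L : ∀ {w} → Far w → w ∈ L
          far⇒∈L {w} far with u ~? w
          ... | yes u~w = ∈neighbours⁺ u~w
          ... | no u≁w  = contradiction (w , far , u≁w) none

          full : ∀ w → w ∈ L ++ map P L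
          full w with side w Bool.≟ side u
          ... | no far = ∈-++⁺ˡ (far⇒∈L far)
          ... | yes near = ∈-++⁺ʳ L (subst (_∈ map P L) (P-inv w)
                  (∈-map⁺ P (far⇒∈L (near⇒far (P-adj w) near))))

          few : length (L ++ map P L) < 2 * k + 2
          few = ℕ.≤-<-trans
            (subst₂ _≤_ (sym (trans (length-++ L) (cong (length L +_) (length-map P L))))
              (cong (k +_) (sym (ℕ.+-identityʳ k))) (ℕ.+-mono-≤ degree≤k degree≤k))
            (ℕ.m<m+n (2 * k) (s≤s z≤n))

        P-closed⇒⊥ : ⊥
        P-closed⇒⊥ = conclude (h-valid v)
          where
          b = proj₁ farNonNeighbour
          u≁b = proj₂ (proj₂ farNonNeighbour)
          open Exposing (exposing (far⇒∈S (proj₁ (proj₂ farNonNeighbour))))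

          h-adj : ∀ {w} → w ≢ b → w ≢ u → w ~ h w
          h-adj {w} w≢b w≢u with h-valid w
          ... | inj₂ (w~hw , _) = w~hw
          ... | inj₁ hw≡w with unmatched hw≡w
          ...   | inj₁ w≡b = contradiction w≡b w≢b
          ...   | inj₂ (gw≡w , w≢Pu) = contradiction (fixed⇒ gw≡w w≢Pu) w≢u

          -- The only vertices that `h` may leave unmatched are `b` and `u`. Neither is a neighbour
          -- of `u`, so `h` prescribes a partner for each of the at most `k` neighbours.
          extension = extendInvolution h-inv h-adj (neighbours u) degree≤k
            (λ v∈ → h-adj (λ { refl → u≁b (∈neighbours⁻ v∈) }) (~⇒≢ (~-sym (∈neighbours⁻ v∈))))

          P′ = proj₁ extension
          -- As a neighbour of `u`, this vertex has its partner prescribed by `h`. That partner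
          -- would have to be `u`, but `h` only uses edges that avoid `u`.
          v = P′ u

          u~v : u ~ v
          u~v = proj₁ (proj₂ (proj₂ extension)) u

          hv≡u : h v ≡ u
          hv≡u = trans (sym (proj₂ (proj₂ (proj₂ extension)) (∈neighbours⁺ u~v))) (proj₁ (proj₂ extension) u)

          conclude : h v ≡ v ⊎ v R h v → ⊥
          conclude (inj₁ hv≡v) = ~⇒≢ u~v (trans (sym hv≡u) hv≡v)
          conclude (inj₂ (_ , _ , hv≢u)) = hv≢u hv≡u

    -- An augmenting path would end at an unmatched vertex on the side of `u` other than `u`, and
    -- there is none. A closed tree stays closed when `u` is put back, since the partner `P u` of
    -- `u` is the root.
    final⇒⊥ : ∀ {S} → Tree S → Final S → ⊥
    final⇒⊥ T (stuck s∈S (s~y , _ , y≢u) gy≡y) =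
      y≢u (fixed⇒ gy≡y (near⇒≢Pu (far⇒near s~y (Tree.inC T s∈S))))
    final⇒⊥ {S} T (closed g-closed) = P-closed⇒⊥ T P-closed
      where
      open Tree T
      P-closed : ∀ {s y} → s ∈ S → s ~ y → P y ∈ S
      P-closed {s} {y} s∈S s~y with y ≟ u
      ... | yes refl = root
      ... | no y≢u = subst (_∈ S) (g-kept y≢u (near⇒≢Pu (far⇒near s~y (inC s∈S))))
              (g-closed s∈S (s~y , (λ { refl → inC s∈S refl }) , y≢u))

    absurd : ⊥
    absurd = let S , T , final = tree in final⇒⊥ T final

  k<degree : ∀ u → k < length (neighbours u)
  k<degree u = ℕ.≰⇒> λ degree≤k →
    let _ , P-inv , P-adj = perfectInvolution in SmallDegree.absurd u degree≤k P-inv P-adj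

  -- Double counting of ordered adjacent pairs

  arcs : List (Fin n × Fin n)
  arcs = filter (λ (u , v) → u ~? v) (cartesianProduct (allFin n) (allFin n))

  arcs⊆ : arcs ⊆ edges G ++ map Product.swap (edges G)
  arcs⊆ {u , v} uv∈ with Matchings.orient G (proj₂ (∈-filter⁻ (λ (u , v) → u ~? v)
                            {xs = cartesianProduct (allFin n) (allFin n)} uv∈))
  ... | _ , e∈ , inj₁ refl = ∈-++⁺ˡ e∈
  ... | _ , e∈ , inj₂ refl = ∈-++⁺ʳ (edges G) (∈-map⁺ Product.swap e∈)

  arcs≤2*edges : length arcs ≤ numEdges G + numEdges G
  arcs≤2*edges = subst (length arcs ≤_)
    (trans (length-++ (edges G)) (cong (numEdges G +_) (length-map Product.swap (edges G))))
    (unique⇒length≤ (Unique.filter⁺ (λ (u , v) → u ~? v)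
      (Unique.cartesianProduct⁺ (Unique.allFin⁺ n) (Unique.allFin⁺ n))) arcs⊆)

  -- Row by row: the pairs that start at `u` are as many as the neighbours of `u`, hence at least
  -- `suc k`.
  arcs≥ : ∀ us → length us * suc k ≤ length (filter (λ (u , v) → u ~? v) (cartesianProduct us (allFin n)))
  arcs≥ [] = z≤n
  arcs≥ (u ∷ us) = subst (suc k + length us * suc k ≤_) (sym split) (ℕ.+-mono-≤ (k<degree u) (arcs≥ us))
    where
    adj? = λ ((u , v) : Fin n × Fin n) → u ~? v

    row : ∀ vs → length (filter adj? (map (u ,_) vs)) ≡ length (filter (u ~?_) vs)
    row [] = refl
    row (v ∷ vs) with does (u ~? v)
    ... | true  = cong suc (row vs)
    ... | false = row vs

    split : length (filter adj? (cartesianProduct (u ∷ us) (allFin n))) ≡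
            length (neighbours u) + length (filter adj? (cartesianProduct us (allFin n)))
    split = trans (cong length (filter-++ adj? (map (u ,_) (allFin n)) _))
      (trans (length-++ (filter adj? (map (u ,_) (allFin n)))) (cong (_+ length (filter adj? (cartesianProduct us (allFin n)))) (row (allFin n))))

  n*[1+k]≤2*edges : n * suc k ≤ numEdges G + numEdges G
  n*[1+k]≤2*edges = ℕ.≤-trans (subst (λ m → m * suc k ≤ length arcs) (length-allFin n) (arcs≥ (allFin n))) arcs≤2*edges

-- Rotations of Fin (suc p)

module Rotation (p : ℕ) where

  -- Addition of 1 in the integers modulo `suc p`; the greatest element wraps around to zero.
  rotate : Fin (suc p) → Fin (suc p)
  rotate i with Top.view i
  ... | Top.‵fromℕ         = Fin.zero
  ... | Top.‵inj₁ {i = j} _ = Fin.suc j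

  rotate-fromℕ : rotate (Fin.fromℕ p) ≡ Fin.zero
  rotate-fromℕ rewrite Top.view-fromℕ p = refl

  rotate-inject₁ : ∀ i → rotate (Fin.inject₁ i) ≡ Fin.suc i
  rotate-inject₁ i rewrite Top.view-inject₁ i = refl

  -- From `i`, climb to the greatest element, wrap around to zero, and climb to any `j`.
  rotate-closed⇒full : (X : Fin (suc p) → Set) → (∀ {i} → X i → X (rotate i)) → ∀ {i} → X i → ∀ j → X j
  rotate-closed⇒full X step {i} Xi = <-weakInduction X X-zero (λ j → up {j})
    where
    up : ∀ {j} → X (Fin.inject₁ j) → X (Fin.suc j)
    up {j} = subst X (rotate-inject₁ j) ∘ step

    X-fromℕ : X (Fin.fromℕ p)
    X-fromℕ = >-weakInduction (λ j → X j → X (Fin.fromℕ p)) id (λ j ih → ih ∘ up) i Xi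

    X-zero : X Fin.zero
    X-zero = subst X rotate-fromℕ (step X-fromℕ)

  ∈-iterate-weaken : ∀ {x} s t → x ∈ iterate rotate s t → x ∈ iterate rotate s (suc t)
  ∈-iterate-weaken s (suc t) (here eq)  = here eq
  ∈-iterate-weaken s (suc t) (there x∈) = there (∈-iterate-weaken (rotate s) t x∈)

  ∈-iterate-rotate : ∀ {x} s t → x ∈ iterate rotate s t → rotate x ∈ iterate rotate s (suc t)
  ∈-iterate-rotate s (suc t) (here refl) = there (here refl)
  ∈-iterate-rotate s (suc t) (there x∈)  = there (∈-iterate-rotate (rotate s) t x∈)

  -- `X` is a part of the sumset S + {0, ..., t}; the list `iterate rotate s (suc t)` consists of
  -- the shifts of `s` by 0 to t. It witnesses that this sumset is everything or has at least
  -- `length S + t` elements.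
  record Expansion (S : List (Fin (suc p))) (t : ℕ) : Set where
    field
      X      : List (Fin (suc p))
      unique : Unique X
      S⊆X    : S ⊆ X
      source : ∀ {x} → x ∈ X → ∃[ s ] (s ∈ S × x ∈ iterate rotate s (suc t))
      large  : (∀ x → x ∈ X) ⊎ length S + t ≤ length X

  -- If `X` has an element whose rotation is missing, adding that rotation gains one element at the
  -- cost of one more shift. Otherwise `X` is nonempty and closed under rotation, hence full.
  expandStep : ∀ {S s t} → s ∈ S → Expansion S t → Expansion S (suc t)
  expandStep {S} {_} {t} s∈S E with any? (λ x → (x ∈? Expansion.X E) ×-dec ¬? (rotate x ∈? Expansion.X E))
  ... | yes (x , x∈X , x′∉X) = let open Expansion E in record
    { X = rotate x ∷ X
    ; unique = unique-∷ x′∉X unique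
    ; S⊆X = there ∘ S⊆X
    ; source = λ
      { (here refl) → let s , s∈S , x∈ = source x∈X in s , s∈S , ∈-iterate-rotate s (suc t) x∈
      ; (there y∈X) → let s , s∈S , y∈ = source y∈X in s , s∈S , ∈-iterate-weaken s (suc t) y∈ }
    ; large = Sum.map (there ∘_)
        (λ S+t≤X → subst (_≤ suc (length X)) (sym (ℕ.+-suc (length S) t)) (s≤s S+t≤X)) large
    }
  ... | no none = let open Expansion E in record
    { X = X
    ; unique = unique
    ; S⊆X = S⊆X
    ; source = λ y∈X → let s , s∈S , y∈ = source y∈X in s , s∈S , ∈-iterate-weaken s (suc t) y∈
    ; large = inj₁ (rotate-closed⇒full (_∈ X)
        (λ {x} x∈X → decidable-stable (rotate x ∈? X) (λ x′∉X → none (x , x∈X , x′∉X))) (S⊆X s∈S))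
    }

  expand : ∀ {S s} → Unique S → s ∈ S → ∀ t → Expansion S t
  expand {S} u _ zero = record
    { X = S ; unique = u ; S⊆X = id ; source = λ x∈S → _ , x∈S , here refl
    ; large = inj₂ (ℕ.≤-reflexive (ℕ.+-identityʳ (length S))) }
  expand u s∈S (suc t) = expandStep s∈S (expand u s∈S t)

length-concatMap : ∀ (h : A → List B) {c} → (∀ x → length (h x) ≡ c) → ∀ xs →
                   length (concatMap h xs) ≡ length xs * c
length-concatMap h len [] = refl
length-concatMap h len (x ∷ xs) = trans (length-++ (h x)) (cong₂ _+_ (len x) (length-concatMap h len xs))

-- The circulant bipartite graph

module Circulant (p k : ℕ) (1≤k : 1 ≤ k) where
  open Rotation p

  q = suc p
  Vertex = Fin (q * 2)

  pattern ℓ = Fin.zero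
  pattern r = Fin.suc Fin.zero

  opaque
    vertex : Fin 2 → Fin q → Vertex
    vertex c i = Fin.combine i c

    pos : Vertex → Fin q
    pos w = proj₁ (Fin.remQuot {q} 2 w)

    side : Vertex → Fin 2
    side w = proj₂ (Fin.remQuot {q} 2 w)

    pos-vertex : ∀ c i → pos (vertex c i) ≡ i
    pos-vertex c i = cong proj₁ (Fin.remQuot-combine i c)

    side-vertex : ∀ c i → side (vertex c i) ≡ c
    side-vertex c i = cong proj₂ (Fin.remQuot-combine i c)

    vertex-pos : ∀ {c} w → side w ≡ c → vertex c (pos w) ≡ w
    vertex-pos w refl = Fin.combine-remQuot {q} 2 w

  vertex-injective : ∀ c {i j} → vertex c i ≡ vertex c j → i ≡ j
  vertex-injective c {i} {j} eq = trans (sym (pos-vertex c i)) (trans (cong pos eq) (pos-vertex c j))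

  part : Fin 2 → List Vertex
  part c = map (vertex c) (allFin q)

  part-unique : ∀ c → Unique (part c)
  part-unique c = Unique.map⁺ (vertex-injective c) (Unique.allFin⁺ q)

  ∈part : ∀ {c w} → side w ≡ c → w ∈ part c
  ∈part {c} {w} eq = subst (_∈ part c) (vertex-pos w eq) (∈-map⁺ (vertex c) (∈-allFin (pos w)))

  part⇒side : ∀ {c w} → w ∈ part c → side w ≡ c
  part⇒side {c} w∈ with ∈-map⁻ (vertex c) w∈
  ... | i , _ , refl = side-vertex c i

  length-part : ∀ c → length (part c) ≡ q
  length-part c = trans (length-map (vertex c) (allFin q)) (length-allFin q)

  record Arc (u v : Vertex) : Set where
    constructor arc
    field
      tail  : side u ≡ ℓ
      head  : side v ≡ r
      reach : pos v ∈ iterate rotate (pos u) (suc k)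

  arc? : Decidable Arc
  arc? u v = map′ (λ (t , h , reach) → arc t h reach) (λ (arc t h reach) → t , h , reach)
    ((side u ≟ ℓ) ×-dec ((side v ≟ r) ×-dec (pos v ∈? iterate rotate (pos u) (suc k))))

  ℓ≢r : ∀ {c : Fin 2} → c ≡ ℓ → c ≢ r
  ℓ≢r refl ()

  arc⇒side≢ : ∀ {u v} → Arc u v → side u ≢ side v
  arc⇒side≢ (arc u≡ℓ v≡r _) u≡v = ℓ≢r u≡ℓ (trans u≡v v≡r)

  ~⇒side≢ : ∀ {u v} → Arc u v ⊎ Arc v u → side u ≢ side v
  ~⇒side≢ (inj₁ a) = arc⇒side≢ a
  ~⇒side≢ (inj₂ a) = arc⇒side≢ a ∘ sym

  graph : Graph (q * 2)
  graph = record
    { _~_ = λ u v → Arc u v ⊎ Arc v u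
    ; ~-sym = Sum.swap
    ; ~-irrefl = λ u≡v u~v → ~⇒side≢ u~v (cong side u≡v)
    ; _~?_ = λ u v → arc? u v ⊎-dec arc? v u
    }

  open Graph graph
  open Matchings graph

  other : {a b c : Fin 2} → a ≢ b → c ≢ a → c ≡ b
  other {ℓ} {ℓ}     a≢b _   = contradiction refl a≢b
  other {r} {r}     a≢b _   = contradiction refl a≢b
  other {ℓ} {r} {ℓ} _   c≢a = contradiction refl c≢a
  other {ℓ} {r} {r} _   _   = refl
  other {r} {ℓ} {ℓ} _   _   = refl
  other {r} {ℓ} {r} _   c≢a = contradiction refl c≢a

  bipartite : Bipartite graph
  bipartite = colour ∘ side , λ u~v eq → ~⇒side≢ u~v (colour-injective eq)
    where
    colour : Fin 2 → Bool
    colour ℓ = false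
    colour r = true

    colour-injective : ∀ {c d} → colour c ≡ colour d → c ≡ d
    colour-injective {ℓ} {ℓ} _ = refl
    colour-injective {r} {r} _ = refl
    colour-injective {ℓ} {r} ()
    colour-injective {r} {ℓ} ()

  arc-vertex : ∀ {i j} → j ∈ iterate rotate i (suc k) → Arc (vertex ℓ i) (vertex r j)
  arc-vertex {i} {j} j∈ = arc (side-vertex ℓ i) (side-vertex r j)
    (subst₂ (λ i j → j ∈ iterate rotate i (suc k)) (sym (pos-vertex ℓ i)) (sym (pos-vertex r j)) j∈)

  ~ℓ⇒r : ∀ {u v} → u ~ v → side u ≡ ℓ → side v ≡ r
  ~ℓ⇒r (inj₁ (arc _ v≡r _)) _   = v≡r
  ~ℓ⇒r (inj₂ (arc _ u≡r _)) u≡ℓ = contradiction u≡r (ℓ≢r u≡ℓ)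

  ~r⇒ℓ : ∀ {u v} → u ~ v → side u ≡ r → side v ≡ ℓ
  ~r⇒ℓ (inj₁ (arc u≡ℓ _ _)) u≡r = contradiction u≡r (ℓ≢r u≡ℓ)
  ~r⇒ℓ (inj₂ (arc v≡ℓ _ _)) _   = v≡ℓ

  -- The step from left `i` to right `i + 1` to left `i + 1` uses the shifts 1 and 0, which are
  -- available as `1 ≤ k`. So the set of left positions that can be reached is closed under
  -- rotation.
  connected : Connected graph
  connected u v = subst (Star _~_ u) (vertex-pos v refl) (reachAll (side v) (pos v))
    where
    rotated : ∀ {k} → 1 ≤ k → ∀ i → rotate i ∈ iterate rotate i (suc k)
    rotated (s≤s _) i = there (here refl)

    start : ∀ c i → Star _~_ (vertex c i) (vertex ℓ i)
    start ℓ i = ε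
    start r i = inj₂ (arc-vertex (here refl)) ◅ ε

    reachℓ : ∀ j → Star _~_ u (vertex ℓ j)
    reachℓ = rotate-closed⇒full (λ j → Star _~_ u (vertex ℓ j))
      (λ {i} path → path ◅◅ (inj₁ (arc-vertex (rotated 1≤k i)) ◅ inj₂ (arc-vertex (here refl)) ◅ ε))
      (subst (λ w → Star _~_ w (vertex ℓ (pos u))) (vertex-pos u refl) (start (side u) (pos u)))

    reachAll : ∀ c j → Star _~_ u (vertex c j)
    reachAll ℓ j = reachℓ j
    reachAll r j = reachℓ j ◅◅ (inj₁ (arc-vertex (here refl)) ◅ ε)

  -- It suffices to cover the edges by a list of this length, with `suc k` entries for each left
  -- position; each entry is oriented so that the smaller vertex comes first, as in `edges`.
  numEdges≤ : numEdges graph ≤ q * suc k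
  numEdges≤ = subst (numEdges graph ≤_) length-listed (unique⇒length≤ edges-unique edges⊆)
    where
    edge : Fin q → Fin q → Vertex × Vertex
    edge i j with vertex ℓ i Fin.<? vertex r j
    ... | yes _ = vertex ℓ i , vertex r j
    ... | no _  = vertex r j , vertex ℓ i

    row : Fin q → List (Vertex × Vertex)
    row i = map (edge i) (iterate rotate i (suc k))

    length-listed : length (concatMap row (allFin q)) ≡ q * suc k
    length-listed = trans
      (length-concatMap row (λ i → trans (length-map (edge i) (iterate rotate i (suc k)))
                                     (length-iterate rotate i (suc k))) (allFin q))
      (cong (_* suc k) (length-allFin q))

    edge-< : ∀ {i j} → vertex ℓ i Fin.< vertex r j → edge i j ≡ (vertex ℓ i , vertex r j)
    edge-< {i} {j} i<j with vertex ℓ i Fin.<? vertex r j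
    ... | yes _  = refl
    ... | no i≮j = contradiction i<j i≮j

    edge-> : ∀ {i j} → vertex r j Fin.< vertex ℓ i → edge i j ≡ (vertex r j , vertex ℓ i)
    edge-> {i} {j} j<i with vertex ℓ i Fin.<? vertex r j
    ... | yes i<j = contradiction i<j (ℕ.<-asym j<i)
    ... | no _    = refl

    listed : ∀ {i j e} → j ∈ iterate rotate i (suc k) → edge i j ≡ e → e ∈ concatMap row (allFin q)
    listed {i} j∈ refl = ∈-concatMap⁺ row (lose (∈-allFin i) (∈-map⁺ (edge i) j∈))

    edges⊆ : edges graph ⊆ concatMap row (allFin q)
    edges⊆ {u , v} uv∈ with ∈edges⁻ uv∈
    ... | u<v , inj₁ (arc u≡ℓ v≡r v∈) = listed v∈ (trans
      (edge-< (subst₂ Fin._<_ (sym (vertex-pos u u≡ℓ)) (sym (vertex-pos v v≡r)) u<v))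
      (cong₂ _,_ (vertex-pos u u≡ℓ) (vertex-pos v v≡r)))
    ... | u<v , inj₂ (arc v≡ℓ u≡r u∈) = listed u∈ (trans
      (edge-> (subst₂ Fin._<_ (sym (vertex-pos u u≡r)) (sym (vertex-pos v v≡ℓ)) u<v))
      (cong₂ _,_ (vertex-pos u u≡r) (vertex-pos v v≡ℓ)))

  -- The parts have equal size, so `g`, which maps part `c` injectively into part `d`, is onto. A
  -- fixed point in part `d` would be the image of a vertex of part `c`, hence equal to it.
  matched-other : ∀ {c d} g → c ≢ d → Involutive _≡_ g → (∀ w → g w ≡ w ⊎ w ~ g w) →
                  (∀ {w} → side w ≡ c → g w ≢ w) → ∀ {w} → side w ≡ d → g w ≢ w
  matched-other {c} {d} g c≢d inv valid matched {w} w≡d gw≡w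
    with injective⇒onto (involutive⇒injective inv) (part-unique c)
           (ℕ.≤-reflexive (trans (length-part d) (sym (length-part c)))) into (∈part w≡d)
    where
    into : ∀ {x} → x ∈ part c → g x ∈ part d
    into {x} x∈ with valid x
    ... | inj₁ gx≡x = contradiction gx≡x (matched (part⇒side x∈))
    ... | inj₂ x~gx = ∈part (other c≢d (λ gx≡c → ~⇒side≢ x~gx (trans (part⇒side x∈) (sym gx≡c))))
  ... | x , x∈ , w≡gx = c≢d (trans (sym (part⇒side x∈)) (trans (cong side x≡w) w≡d))
    where
    x≡w : x ≡ w
    x≡w = trans (flip inv (sym w≡gx)) gw≡w

  -- Extending matchings of size at most k in the circulant graph

  module Extension {M : List (Vertex × Vertex)} (matching : IsMatching graph M) (M≤k : length M ≤ k) where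
    open IsMatching matching

    -- The edges compatible with M: those of M and those disjoint from all edges of M
    _R_ : Rel Vertex 0ℓ
    x R y = x ~ y × (Covered M x → Joined M x y) × (Covered M y → Joined M x y)

    R-sym : Symmetric _R_
    R-sym (x~y , x⇒ , y⇒) = ~-sym x~y , joined-sym ∘ y⇒ , joined-sym ∘ x⇒

    _R?_ : Decidable _R_
    x R? y = (x ~? y) ×-dec ((covered? M x →-dec joined? M x y) ×-dec (covered? M y →-dec joined? M x y))

    Free : Fin 2 → Vertex → Set
    Free c w = side w ≡ c × ¬ Covered M w

    free-across : ∀ {c d} → (∀ {x y} → x ~ y → side x ≡ c → side y ≡ d) → ∀ {x y} → x R y → Free c x → Free d y
    free-across across (x~y , x⇒ , y⇒) (x≡c , uncovered) =
      across x~y x≡c , λ cov → uncovered (_ , y⇒ cov)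

    record Extending (ws : List Vertex) : Set where
      field
        g        : Vertex → Vertex
        inv      : Involutive _≡_ g
        valid    : Valid _R_ g
        free     : ∀ {w} → g w ≡ w → ¬ Covered M w
        matched  : ∀ {w} → w ∈ ws → g w ≢ w

    initial : Extending []
    initial = let g , inv , joined , valid = disjoint⇒involution disjoint in record
      { g = g
      ; inv = inv
      ; valid = λ w → Sum.map₂ (λ wgw → joined⇒~ matching wgw , (λ _ → wgw) , (λ _ → wgw)) (valid w)
      ; free = λ { gw≡w (y , wy) → ~-irrefl (trans (sym gw≡w) (joined wy)) (joined⇒~ matching wy) }
      ; matched = λ ()
      }

    rightEnd : Vertex × Vertex → Vertex
    rightEnd (u , v) with side u ≟ r
    ... | yes _ = u
    ... | no _  = v

    rightEnds : List Vertex
    rightEnds = map rightEnd M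

    -- For counting: `M` covers at most `length M` vertices on the right.
    covered⇒∈rightEnds : ∀ {w} → side w ≡ r → Covered M w → w ∈ rightEnds
    covered⇒∈rightEnds {w} w≡r (y , inj₁ wy∈M) = subst (_∈ rightEnds) eq (∈-map⁺ rightEnd wy∈M)
      where
      eq : rightEnd (w , y) ≡ w
      eq with side w ≟ r
      ... | yes _  = refl
      ... | no w≢r = contradiction w≡r w≢r
    covered⇒∈rightEnds {w} w≡r (y , inj₂ yw∈M) = subst (_∈ rightEnds) eq (∈-map⁺ rightEnd yw∈M)
      where
      eq : rightEnd (y , w) ≡ w
      eq with side y ≟ r
      ... | yes y≡r = contradiction (trans y≡r (sym w≡r)) (~⇒side≢ (joined⇒~ matching (inj₁ yw∈M)))
      ... | no _    = refl

    module Augment {ws : List Vertex} (E : Extending ws) {w : Vertex} (w≡ℓ : side w ≡ ℓ)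
                   (gw≡w : Extending.g E w ≡ w) where
      open Extending E
      open AlternatingTree {_R_ = _R_} R-sym _R?_ (Free ℓ) (Free r)
        (free-across ~ℓ⇒r) (free-across ~r⇒ℓ) (λ (x≡ℓ , _) (x≡r , _) → ℓ≢r x≡ℓ x≡r)
        inv valid (w≡ℓ , free gw≡w) gw≡w

      -- If every right vertex were matched, `matched-other` would make the left vertex `w` matched
      -- as well.
      freeRight : ∃[ i ] g (vertex r i) ≡ vertex r i
      freeRight with any? (λ i → g (vertex r i) ≟ vertex r i)
      ... | yes found = found
      ... | no none = contradiction gw≡w (matched-other g (λ ()) inv (λ x → Sum.map₂ proj₁ (valid x))
        (λ {x} x≡r gx≡x → none (pos x , subst (λ y → g y ≡ y) (sym (vertex-pos x x≡r)) gx≡x)) w≡ℓ)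

      -- Hall's condition without the vertices of `M`. Let `X` be the expansion of `S` by `k`
      -- shifts, a set of right neighbours of `S`. Closedness puts the partners of its uncovered
      -- elements into `S`. If `X` is everything, it contains an unmatched right vertex, which would
      -- then be in `S`; if not, `X` has at least `length S + k` elements, too many for `S` and `M`
      -- together.
      not-closed : ∀ {S} → Tree S → ¬ (∀ {s y} → s ∈ S → s R y → g y ∈ S)
      not-closed {S} T g-closed = [ full⇒⊥ , large⇒⊥ ] large
        where
        open Tree T using (root; inC)

        S′ : List (Fin q)
        S′ = filter (λ i → vertex ℓ i ∈? S) (allFin q)

        ∈S⇒∈S′ : ∀ {s} → s ∈ S → pos s ∈ S′
        ∈S⇒∈S′ {s} s∈S = ∈-filter⁺ (λ i → vertex ℓ i ∈? S) (∈-allFin (pos s))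
          (subst (_∈ S) (sym (vertex-pos s (proj₁ (inC s∈S)))) s∈S)

        S≤S′ : length S ≤ length S′
        S≤S′ = subst (length S ≤_) (length-map (vertex ℓ) S′) (unique⇒length≤ (Tree.unique T)
          (λ {s} s∈S → subst (_∈ map (vertex ℓ) S′) (vertex-pos s (proj₁ (inC s∈S)))
            (∈-map⁺ (vertex ℓ) (∈S⇒∈S′ s∈S))))

        open Expansion (expand (Unique.filter⁺ (λ i → vertex ℓ i ∈? S) (Unique.allFin⁺ q)) (∈S⇒∈S′ root) k)

        matched-in-S : ∀ {x} → x ∈ X → ¬ Covered M (vertex r x) → g (vertex r x) ∈ S
        matched-in-S x∈X uncovered =
          let s , s∈S′ , x∈ = source x∈X
              s∈S = proj₂ (∈-filter⁻ (λ i → vertex ℓ i ∈? S) {xs = allFin q} s∈S′)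
          in g-closed s∈S (inj₁ (arc-vertex x∈) , (λ cov → contradiction cov (proj₂ (inC s∈S)))
                                               , (λ cov → contradiction cov uncovered))

        full⇒⊥ : ¬ (∀ x → x ∈ X)
        full⇒⊥ full = let i , fixed = freeRight in
          ℓ≢r (proj₁ (inC (subst (_∈ S) fixed (matched-in-S (full i) (free fixed))))) (side-vertex r i)

        -- The root `w` is its own image under `g` and lies on the left, so including it makes the
        -- inequality for `X` strict.
        N = w ∷ map (vertex r) X

        N-unique : Unique N
        N-unique = unique-∷ w∉ (Unique.map⁺ (vertex-injective r) unique)
          where
          w∉ : w ∉ map (vertex r) X
          w∉ w∈ with ∈-map⁻ (vertex r) w∈
          ... | i , _ , refl = ℓ≢r w≡ℓ (side-vertex r i)

        N⊆ : N ⊆ map g S ++ rightEnds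
        N⊆ (here refl) = ∈-++⁺ˡ (subst (_∈ map g S) gw≡w (∈-map⁺ g root))
        N⊆ (there y∈) with ∈-map⁻ (vertex r) y∈
        ... | x , x∈X , refl with covered? M (vertex r x)
        ...   | yes cov = ∈-++⁺ʳ (map g S) (covered⇒∈rightEnds (side-vertex r x) cov)
        ...   | no ¬cov = ∈-++⁺ˡ (subst (_∈ map g S) (inv (vertex r x)) (∈-map⁺ g (matched-in-S x∈X ¬cov)))

        large⇒⊥ : ¬ (length S′ + k ≤ length X)
        large⇒⊥ S′+k≤X = ℕ.<⇒≱ X<S+M (ℕ.≤-trans (ℕ.+-mono-≤ S≤S′ M≤k) S′+k≤X)
          where
          X<S+M : length X < length S + length M
          X<S+M = subst₂ _≤_ (cong suc (length-map (vertex r) X))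
            (trans (length-++ (map g S)) (cong₂ _+_ (length-map g S) (length-map rightEnd M)))
            (unique⇒length≤ N-unique N⊆)

      augmented : Extending (w ∷ ws)
      augmented with tree
      ... | S , T , closed g-closed = ⊥-elim (not-closed T g-closed)
      ... | S , T , stuck s∈S sRy gy≡y =
        let g′ , inv′ , valid′ , unmatched = augment T s∈S sRy gy≡y in record
        { g = g′ ; inv = inv′ ; valid = valid′
        ; free = free ∘ proj₁ ∘ unmatched
        ; matched = λ { (here refl) fixed → proj₂ (unmatched fixed) refl
                      ; (there v∈) → matched v∈ ∘ proj₁ ∘ unmatched } }

    saturate : ∀ ws → (∀ {w} → w ∈ ws → side w ≡ ℓ) → Extending ws
    saturate [] _ = initial
    saturate (w ∷ ws) left with saturate ws (left ∘ there)
    ... | E with Extending.g E w ≟ w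
    ...   | yes gw≡w = Augment.augmented E (left (here refl)) gw≡w
    ...   | no gw≢w = let open Extending E in record
      { g = g ; inv = inv ; valid = valid ; free = free
      ; matched = λ { (here refl) → gw≢w ; (there v∈) → matched v∈ } }

    open Extending (saturate (part ℓ) part⇒side)

    perfect : ∀ w → w R g w
    perfect w with valid w
    ... | inj₂ wRgw = wRgw
    ... | inj₁ gw≡w = contradiction gw≡w (noneFixed (side w) refl)
      where
      noneFixed : ∀ c → side w ≡ c → g w ≢ w
      noneFixed ℓ w≡ℓ = matched (∈part w≡ℓ)
      noneFixed r = matched-other g (λ ()) inv (λ x → Sum.map₂ proj₁ (valid x)) (λ x≡ℓ → matched (∈part x≡ℓ)) {w}

    -- Every vertex has an `_R_`-partner under `g`, and at a vertex covered by `M` an `_R_`-edge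
    -- belongs to `M`; hence `g` contains `M`.
    extension : ∃[ P ] (Involutive _≡_ P × (∀ w → w ~ P w) × (∀ {x y} → Joined M x y → P x ≡ y))
    extension = g , inv , proj₁ ∘ perfect , λ {x} xy →
      joined-functional disjoint (proj₁ (proj₂ (perfect x)) (_ , xy)) xy

  extends : ∀ M → IsMatching graph M → length M ≡ k → ∃[ N ] (IsPerfectMatching graph N × M ⊆ N)
  extends M matching M≡k =
    let P , inv , adj , joined = Extension.extension matching (ℕ.≤-reflexive M≡k)
        open Greedy {P} inv
        -- The greedy choice starts from `M` itself rather than from the empty list, so the edge
        -- list obtained contains `M`.
        N , along , M⊆N , covers , _ = cover (record { isMatching = matching ; along = joined ∘ inj₁ })
          (allFin (q * 2)) (λ _ → adj _)
    in N , record { isMatching = Along.isMatching along ; covers = λ w → covered⇒any (covers (∈-allFin w)) } , M⊆N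

  extendable : 2 * k + 2 ≤ q * 2 → IsExtendable k graph
  extendable bound = record
    { connected = connected
    ; bound = bound
    ; hasMatching =
        -- Extending the empty matching gives a perfect matching, from which `k` edges are taken.
        let P , inv , adj , _ = Extension.extension {[]} (record { isEdges = λ () ; disjoint = [] }) z≤n
            open Greedy {P} inv
            M , along , _ , len = pad {vertex ℓ Fin.zero} {vertex ℓ Fin.zero} (λ {w} _ _ → adj w) k empty
              (subst (λ m → 2 * m + 2 ≤ q * 2) (sym (ℕ.+-identityʳ k)) bound)
        in M , Along.isMatching along , trans len (ℕ.+-identityʳ k)
    ; extends = extends
    }

-- Assembly of the two bounds, with ν written as twice q

lowerBound : ∀ {q k} {G : Graph (q * 2)} → 1 ≤ k → Bipartite G → IsExtendable k G → q * suc k ≤ numEdges G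
lowerBound {q} {k} {G} 1≤k bip ext = ℕ.*-cancelˡ-≤ 2 (subst₂ _≤_ (rearrange q (suc k)) (double (numEdges G))
  (MinimumDegree.n*[1+k]≤2*edges bip 1≤k ext))
  where
  rearrange : ∀ q d → q * 2 * d ≡ 2 * (q * d)
  rearrange = solve-∀
  double : ∀ m → m + m ≡ 2 * m
  double = solve-∀

halve : ∀ q k → q * 2 * (k + 1) / 2 ≡ q * suc k
halve q k = trans (cong (_/ 2) (rearrange q k)) (m*n/n≡m (q * suc k) 2)
  where
  rearrange : ∀ q k → q * 2 * (k + 1) ≡ q * suc k * 2
  rearrange = solve-∀

mainTheorem2 : ∀ (k ν : ℕ) → 1 ≤ k → 2 * k + 2 ≤ ν → 2 ∣ ν →
    IsMinimum (ExtendableBipartiteWithEdges k ν) (ν * (k + 1) / 2)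
-- The case ν = 0 contradicts the bound, so q is a successor, as the rotations require.
mainTheorem2 k _ 1≤k bound (divides zero refl) = contradiction (ℕ.m+n≤o⇒n≤o (2 * k) bound) λ ()
mainTheorem2 k _ 1≤k bound (divides (suc p) refl) =
  (graph , bipartite , extendable bound , trans
    (ℕ.≤-antisym numEdges≤ (lowerBound {suc p} 1≤k bipartite (extendable bound))) (sym (halve (suc p) k))) ,
  λ { (G , bip , ext , refl) → subst (_≤ numEdges G) (sym (halve (suc p) k)) (lowerBound {suc p} 1≤k bip ext) }
  where open Circulant p k 1≤k
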